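{- Let $a,b$ be integers with $a>0$ and $b<0$, and let $\{P_n(x)\}_{n=0}^{\infty}$ be the polynomial sequence with generating function $$\sum_{n=0}^{\infty}P_n(x)\frac{z^n}{n!}=e^{xz+az^2+bz^4}.$$ Consider the marked generating tree whose root (at level $0$) is a single non-marked node $(0)$, and whose nodes produce children according to the succession rule, for every $k\ge 0$, $$(k)\rightarrow(\overline{k-3})^{24|b|\binom{k}{3}}\,(k-1)^{2ak}\,(k+1)^1,\qquad (\bar k)\rightarrow(k-3)^{24|b|\binom{k}{3}}\,(\overline{k-1})^{2ak}\,(\overline{k+1})^1 .$$ For $n\ge 0$ and $k=0,1,\ldots,n$, let $\mu_n(k)$ and $\mu_n(\bar k)$ denote respectively the number of non-marked nodes $(k)$ and the number of marked nodes $(\bar k)$ at level $n$ of this tree. Then $$[x^k]P_n(x)=\mu_n(k)-\mu_n(\bar k).$$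
   Context: $[x^k]P_n(x)$ denotes the coefficient of $x^k$ in $P_n(x)$. A marked generating tree is a rooted labeled tree in which every node carries either a non-marked label $k$ (such a node is denoted $(k)$) or a marked label $\bar k$ (denoted $(\bar k)$), with $k$ a nonnegative integer. The succession rule specifies the children of each node in terms of its label: a node at level $n$ with the label on the left of the arrow has as its children, at level $n+1$, exactly the nodes listed on the right, where $(i)^p$ (resp. $(\bar i)^p$) means $p$ nodes with label $i$ (resp. $\bar i$), and exponent $0$ means no such node (so, e.g., no node with label $k-3$ is produced when $k<3$, and no node with label $k-1$ is produced when $k=0$). -}

module Defs where

open import Data.Bool using (if_then_else_)
open import Data.Integer as ℤ using (ℤ; +_; ∣_∣)
open import Data.List using (List; []; _∷_; _++_; map; replicate; concatMap; filter; length)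
open import Data.Nat as ℕ using (ℕ; zero; suc; _∸_; _≡ᵇ_; _!)
open import Data.Nat.Combinatorics using (_C_)
open import Data.Nat.Properties using (_!≢0)
open import Data.Rational as ℚ using (ℚ; 0ℚ; 1ℚ)
open import Relation.Binary.Definitions using (DecidableEquality)
open import Relation.Binary.PropositionalEquality using (_≡_; refl; cong)
open import Relation.Nullary using (yes; no)

-- The polynomial c₀ + c₁ x + c₂ x² + ⋯ is the list c₀ ∷ c₁ ∷ c₂ ∷ ⋯ ∷ [].
-- Trailing zeros are allowed, so equality of polynomials is _≈ₚ_, not _≡_.
Poly : Set
Poly = List ℚ

[x^_]_ : ℕ → Poly → ℚ
[x^ k ]     []      = 0ℚ
[x^ zero ]  (c ∷ p) = c
[x^ suc k ] (c ∷ p) = [x^ k ] p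

infix 4 _≈ₚ_
_≈ₚ_ : Poly → Poly → Set
p ≈ₚ q = ∀ k → [x^ k ] p ≡ [x^ k ] q

infixl 6 _+ₚ_
_+ₚ_ : Poly → Poly → Poly
[]      +ₚ q       = q
(c ∷ p) +ₚ []      = c ∷ p
(c ∷ p) +ₚ (d ∷ q) = (c ℚ.+ d) ∷ (p +ₚ q)

infixr 7 _·ₚ_
_·ₚ_ : ℚ → Poly → Poly
c ·ₚ p = map (c ℚ.*_) p

infixl 7 _*ₚ_
_*ₚ_ : Poly → Poly → Poly
[]      *ₚ q = []
(c ∷ p) *ₚ q = c ·ₚ q +ₚ (0ℚ ∷ p *ₚ q)

constₚ : ℚ → Poly
constₚ c = c ∷ []

X : Poly
X = 0ℚ ∷ 1ℚ ∷ []

Σₚ≤ : ℕ → (ℕ → Poly) → Poly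
Σₚ≤ zero    f = f zero
Σₚ≤ (suc n) f = Σₚ≤ n f +ₚ f (suc n)

-- Formal power series in z over ℚ[x]: n ↦ coefficient of zⁿ.
Series : Set
Series = ℕ → Poly

infix 4 _≈ₛ_
_≈ₛ_ : Series → Series → Set
f ≈ₛ g = ∀ n → f n ≈ₚ g n

infixl 6 _+ₛ_
_+ₛ_ : Series → Series → Series
(f +ₛ g) n = f n +ₚ g n

infixl 7 _*ₛ_
_*ₛ_ : Series → Series → Series
(f *ₛ g) n = Σₚ≤ n (λ i → f i *ₚ g (n ∸ i))

infixl 8 _z^_
_z^_ : Poly → ℕ → Series
(p z^ i) n = if i ≡ᵇ n then p else []

infixr 8 _^ₛ_
_^ₛ_ : Series → ℕ → Series
f ^ₛ zero  = constₚ 1ℚ z^ 0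
f ^ₛ suc m = f *ₛ (f ^ₛ m)

1/_! : ℕ → ℚ
1/ n ! = (+ 1) ℚ./ (n !)
  where instance _ = n !≢0

-- Since f has no constant term, f ^ m contributes nothing to the coefficient
-- of zⁿ when m > n, so the sum of all f ^ m / m! is finite in each degree.
exp : (f : Series) → .(f 0 ≈ₚ []) → Series
exp f _ n = Σₚ≤ n (λ m → 1/ m ! ·ₚ (f ^ₛ m) n)

egf : (ℕ → Poly) → Series
egf P n = 1/ n ! ·ₚ P n

fromℤ : ℤ → ℚ
fromℤ i = i ℚ./ 1

exponent : ℤ → ℤ → Series
exponent a b = X z^ 1 +ₛ constₚ (fromℤ a) z^ 2 +ₛ constₚ (fromℤ b) z^ 4

exponent₀≈0 : ∀ a b → exponent a b 0 ≈ₚ []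
exponent₀≈0 a b k = refl

data Label : Set where
  ⟨_⟩  : ℕ → Label
  ⟨_⟩‾ : ℕ → Label

_≟_ : DecidableEquality Label
⟨ k ⟩  ≟ ⟨ l ⟩  with k ℕ.≟ l
... | yes k≡l = yes (cong ⟨_⟩ k≡l)
... | no  k≢l = no λ { refl → k≢l refl }
⟨ k ⟩  ≟ ⟨ l ⟩‾ = no λ ()
⟨ k ⟩‾ ≟ ⟨ l ⟩  = no λ ()
⟨ k ⟩‾ ≟ ⟨ l ⟩‾ with k ℕ.≟ l
... | yes k≡l = yes (cong ⟨_⟩‾ k≡l)
... | no  k≢l = no λ { refl → k≢l refl }

-- The truncated subtractions are harmless: k C 3 = 0 when k < 3, and
-- 2 * ∣ a ∣ * k = 0 when k = 0.  The rule is only used for a > 0, where ∣ a ∣ = a.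
children : ℤ → ℤ → Label → List Label
children a b ⟨ k ⟩ =
     replicate (24 ℕ.* ∣ b ∣ ℕ.* (k C 3)) ⟨ k ∸ 3 ⟩‾
  ++ replicate (2 ℕ.* ∣ a ∣ ℕ.* k)        ⟨ k ∸ 1 ⟩
  ++ replicate 1                          ⟨ k ℕ.+ 1 ⟩
children a b ⟨ k ⟩‾ =
     replicate (24 ℕ.* ∣ b ∣ ℕ.* (k C 3)) ⟨ k ∸ 3 ⟩
  ++ replicate (2 ℕ.* ∣ a ∣ ℕ.* k)        ⟨ k ∸ 1 ⟩‾
  ++ replicate 1                          ⟨ k ℕ.+ 1 ⟩‾

-- The labels of all nodes at level n, one list entry per node.
level : ℤ → ℤ → ℕ → List Label
level a b zero    = ⟨ 0 ⟩ ∷ []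
level a b (suc n) = concatMap (children a b) (level a b n)

μ : ℤ → ℤ → ℕ → Label → ℕ
μ a b n l = length (filter (_≟ l) (level a b n))

{-# OPTIONS --safe #-}
module Submission where

-- Write E = exp(xz + az² + bz⁴).  Then ∂E/∂x = zE and ∂E/∂z = (x + 2az + 4bz³)E,
-- so ∂E/∂z = (x + 2a ∂/∂x + 4b (∂/∂x)³)E.  Hence Pₙ₊₁ = x Pₙ + 2a Pₙ′ + 4b Pₙ‴, and
-- the succession rule is this recurrence read on coefficients, the marks carrying the
-- sign of b: [x^k] of x Pₙ, 2a Pₙ′, 4b Pₙ‴ collects the nodes arriving at k from
-- k − 1, k + 1, k + 3, where 4b (k+1)(k+2)(k+3) = −24|b| C(k+3, 3).

open import Data.Integer as ℤ using (ℤ; +_; -[1+_]; 0ℤ; -_; ∣_∣; _<_; +<+; -<+; _-_)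
import Data.Integer.Properties as ℤ
import Data.Integer.Tactic.RingSolver as ℤ
open import Data.List using (List; []; _∷_; _++_; replicate; concatMap; filter; length)
open import Data.List.Properties using (filter-accept; filter-reject)
open import Data.Nat as ℕ using (ℕ; zero; suc; _≤_; z≤n; s≤s; _!)
open import Data.Nat.Combinatorics using (_C_; nC1≡n; nCk+nC[k+1]≡[n+1]C[k+1])
import Data.Nat.Properties as ℕ
import Data.Nat.Tactic.RingSolver as ℕ
open import Data.Rational as ℚ using (ℚ; 0ℚ; 1ℚ; _+_; _*_; fromℚᵘ)
import Data.Rational.Properties as ℚ
open import Data.Rational.Solver using (module +-*-Solver)
import Data.Rational.Unnormalised as ℚᵘ
import Data.Rational.Unnormalised.Properties as ℚᵘ
open import Data.Sum using (inj₁; inj₂)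
open import Relation.Binary.PropositionalEquality
open import Relation.Nullary using (Dec; yes; no)
open import Defs
open ≡-Reasoning
open +-*-Solver using (solve; con; _:=_; _:+_; _:*_)

-- Truncation shapes the proof: `exp` cuts its sum at a bound that varies with the z-degree, so it
-- cannot be differentiated term by term as it stands. Instead, partial sums with a fixed bound are
-- differentiated. For both derivations the sum up to N + 1 goes exactly to the derivative of the
-- exponent times the sum up to N. Because the exponent is divisible by z, a partial sum agrees with
-- the full series in every degree up to its bound. Multiplication by the exponent is kept as
-- syntax, `Op`, acting on coefficient arrays. Linearity, commutation and causality then become
-- inductions on expressions, and two series are never multiplied. Trading powers of z for powers of
-- ∂/∂x is what makes the recurrence reach back one step in n only, just as a level of the tree
-- depends only on the level before it. On the tree side the signed count is additive over nodes, so
-- only the children of a single node have to be compared with the image of a single monomial x^j.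

fromℚᵘ-homo-+ : ∀ p q → fromℚᵘ (p ℚᵘ.+ q) ≡ fromℚᵘ p + fromℚᵘ q
fromℚᵘ-homo-+ p q = trans
  (ℚ.fromℚᵘ-cong (ℚᵘ.≃-sym (ℚᵘ.≃-trans (ℚ.toℚᵘ-homo-+ (fromℚᵘ p) (fromℚᵘ q))
    (ℚᵘ.+-cong (ℚ.toℚᵘ-fromℚᵘ p) (ℚ.toℚᵘ-fromℚᵘ q)))))
  (ℚ.fromℚᵘ-toℚᵘ _)

fromℚᵘ-homo-* : ∀ p q → fromℚᵘ (p ℚᵘ.* q) ≡ fromℚᵘ p * fromℚᵘ q
fromℚᵘ-homo-* p q = trans
  (ℚ.fromℚᵘ-cong (ℚᵘ.≃-sym (ℚᵘ.≃-trans (ℚ.toℚᵘ-homo-* (fromℚᵘ p) (fromℚᵘ q))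
    (ℚᵘ.*-cong (ℚ.toℚᵘ-fromℚᵘ p) (ℚ.toℚᵘ-fromℚᵘ q)))))
  (ℚ.fromℚᵘ-toℚᵘ _)

fromℤ-homo-+ : ∀ i j → fromℤ (i ℤ.+ j) ≡ fromℤ i + fromℤ j
fromℤ-homo-+ i j = trans
  (cong fromℤ (cong₂ ℤ._+_ (sym (ℤ.*-identityʳ i)) (sym (ℤ.*-identityʳ j))))
  (fromℚᵘ-homo-+ (ℚᵘ.mkℚᵘ i 0) (ℚᵘ.mkℚᵘ j 0))

fromℤ-homo-* : ∀ i j → fromℤ (i ℤ.* j) ≡ fromℤ i * fromℤ j
fromℤ-homo-* i j = fromℚᵘ-homo-* (ℚᵘ.mkℚᵘ i 0) (ℚᵘ.mkℚᵘ j 0)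

fromℕ : ℕ → ℚ
fromℕ n = fromℤ (+ n)

fromℕ-suc : ∀ n → fromℕ (suc n) ≡ 1ℚ + fromℕ n
fromℕ-suc n = fromℤ-homo-+ (+ 1) (+ n)

fromℕ-homo-* : ∀ m n → fromℕ (m ℕ.* n) ≡ fromℕ m * fromℕ n
fromℕ-homo-* m n = trans (cong fromℤ (ℤ.pos-* m n)) (fromℤ-homo-* (+ m) (+ n))

-- Reciprocals of factorials.

1/d*d≡1 : ∀ d .{{_ : ℕ.NonZero d}} → (+ 1 ℚ./ d) * fromℕ d ≡ 1ℚ
1/d*d≡1 (suc d) = trans
  (sym (fromℚᵘ-homo-* (ℚᵘ.mkℚᵘ (+ 1) d) (ℚᵘ.mkℚᵘ (+ suc d) 0)))
  (ℚ.fromℚᵘ-cong {ℚᵘ.mkℚᵘ (+ 1) d ℚᵘ.* ℚᵘ.mkℚᵘ (+ suc d) 0} {ℚᵘ.1ℚᵘ}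
    (ℚᵘ.*≡* (ℤ.*-assoc (+ 1) (+ suc d) (+ 1))))

1/n!*n!≡1 : ∀ n → 1/ n ! * fromℕ (n !) ≡ 1ℚ
1/n!*n!≡1 n = 1/d*d≡1 (n !) where instance _ = n ℕ.!≢0

-- Absorbs the factor n + 1 that differentiating an (n + 1)-st power produces.
1/[1+n]!*[1+n]≡1/n! : ∀ n → 1/ suc n ! * fromℕ (suc n) ≡ 1/ n !
1/[1+n]!*[1+n]≡1/n! n = begin
  r * s                 ≡⟨ ℚ.*-identityʳ _ ⟨
  r * s * 1ℚ            ≡⟨ cong (r * s *_) (1/n!*n!≡1 n) ⟨
  r * s * (t * f)       ≡⟨ solve 4 (λ r s t f → r :* s :* (t :* f) := r :* (s :* f) :* t) refl r s t f ⟩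
  r * (s * f) * t       ≡⟨ cong (λ u → r * u * t) (fromℕ-homo-* (suc n) (n !)) ⟨
  r * fromℕ (suc n !) * t ≡⟨ cong (_* t) (1/n!*n!≡1 (suc n)) ⟩
  1ℚ * t                ≡⟨ ℚ.*-identityˡ t ⟩
  t                     ∎
  where
  r = 1/ suc n !
  s = fromℕ (suc n)
  t = 1/ n !
  f = fromℕ (n !)

-- Bivariate power series and the polynomials that act on them.

-- g n k stands for the coefficient of zⁿxᵏ.
Coeffs : Set
Coeffs = ℕ → ℕ → ℚ

infix 4 _≐_
_≐_ : Coeffs → Coeffs → Set
g ≐ h = ∀ n k → g n k ≡ h n k

infixl 6 _⊞_
_⊞_ : Coeffs → Coeffs → Coeffs
(g ⊞ h) n k = g n k + h n k

infixr 7 _⊡_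
_⊡_ : ℚ → Coeffs → Coeffs
(c ⊡ g) n k = c * g n k

infixr 7 z·_ x·_
z·_ : Coeffs → Coeffs
(z· g) zero    k = 0ℚ
(z· g) (suc n) k = g n k

x·_ : Coeffs → Coeffs
(x· g) n zero    = 0ℚ
(x· g) n (suc k) = g n k

-- Polynomials in z and x, acting on Coeffs by multiplication.
infixl 6 _⊕_
infixl 7 _⊗_
data Op : Set where
  Z ⅹ     : Op
  K       : ℚ → Op
  _⊕_ _⊗_ : Op → Op → Op

⟦_⟧ : Op → Coeffs → Coeffs
⟦ Z ⟧     g = z· g
⟦ ⅹ ⟧     g = x· g
⟦ K c ⟧   g = c ⊡ g
⟦ p ⊕ q ⟧ g = ⟦ p ⟧ g ⊞ ⟦ q ⟧ g
⟦ p ⊗ q ⟧ g = ⟦ p ⟧ (⟦ q ⟧ g)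

-- Multiplication by a polynomial never lowers the z-degree, so nothing above degree n is read. This
-- is what allows a series to be replaced by a truncation under `⟦ p ⟧`.
⟦_⟧-causal : ∀ p {g h} n → (∀ {j} → j ≤ n → ∀ k → g j k ≡ h j k) → ∀ k → ⟦ p ⟧ g n k ≡ ⟦ p ⟧ h n k
⟦ Z ⟧-causal     zero    e k       = refl
⟦ Z ⟧-causal     (suc n) e k       = e (ℕ.n≤1+n n) k
⟦ ⅹ ⟧-causal     n       e zero    = refl
⟦ ⅹ ⟧-causal     n       e (suc k) = e ℕ.≤-refl k
⟦ K c ⟧-causal   n       e k       = cong (c *_) (e ℕ.≤-refl k)
⟦ p ⊕ q ⟧-causal n       e k       = cong₂ _+_ (⟦ p ⟧-causal n e k) (⟦ q ⟧-causal n e k)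
⟦ p ⊗ q ⟧-causal n       e         =
  ⟦ p ⟧-causal n λ j≤n → ⟦ q ⟧-causal _ λ i≤j → e (ℕ.≤-trans i≤j j≤n)

⟦_⟧-cong : ∀ p {g h} → g ≐ h → ⟦ p ⟧ g ≐ ⟦ p ⟧ h
⟦ p ⟧-cong e n = ⟦ p ⟧-causal n λ _ → e _

+-interchange : ∀ a b c d → (a + b) + (c + d) ≡ (a + c) + (b + d)
+-interchange = solve 4 (λ a b c d → (a :+ b) :+ (c :+ d) := (a :+ c) :+ (b :+ d)) refl

*-exchange : ∀ a b c → a * (b * c) ≡ b * (a * c)
*-exchange = solve 3 (λ a b c → a :* (b :* c) := b :* (a :* c)) refl

⟦_⟧-⊞ : ∀ p g h → ⟦ p ⟧ (g ⊞ h) ≐ ⟦ p ⟧ g ⊞ ⟦ p ⟧ h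
⟦ Z ⟧-⊞     g h zero    k       = refl
⟦ Z ⟧-⊞     g h (suc n) k       = refl
⟦ ⅹ ⟧-⊞     g h n       zero    = refl
⟦ ⅹ ⟧-⊞     g h n       (suc k) = refl
⟦ K c ⟧-⊞   g h n k = ℚ.*-distribˡ-+ c _ _
⟦ p ⊕ q ⟧-⊞ g h n k = trans (cong₂ _+_ (⟦ p ⟧-⊞ g h n k) (⟦ q ⟧-⊞ g h n k))
  (+-interchange (⟦ p ⟧ g n k) (⟦ p ⟧ h n k) (⟦ q ⟧ g n k) (⟦ q ⟧ h n k))
⟦ p ⊗ q ⟧-⊞ g h n k = trans (⟦ p ⟧-cong (⟦ q ⟧-⊞ g h) n k) (⟦ p ⟧-⊞ _ _ n k)

⟦_⟧-⊡ : ∀ p c g → ⟦ p ⟧ (c ⊡ g) ≐ c ⊡ ⟦ p ⟧ g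
⟦ Z ⟧-⊡     c g zero    k       = sym (ℚ.*-zeroʳ c)
⟦ Z ⟧-⊡     c g (suc n) k       = refl
⟦ ⅹ ⟧-⊡     c g n       zero    = sym (ℚ.*-zeroʳ c)
⟦ ⅹ ⟧-⊡     c g n       (suc k) = refl
⟦ K d ⟧-⊡   c g n k = *-exchange d c (g n k)
⟦ p ⊕ q ⟧-⊡ c g n k = trans (cong₂ _+_ (⟦ p ⟧-⊡ c g n k) (⟦ q ⟧-⊡ c g n k))
  (sym (ℚ.*-distribˡ-+ c _ _))
⟦ p ⊗ q ⟧-⊡ c g n k = trans (⟦ p ⟧-cong (⟦ q ⟧-⊡ c g) n k) (⟦ p ⟧-⊡ c _ n k)

z·-comm : ∀ p g → ⟦ p ⟧ (z· g) ≐ z· ⟦ p ⟧ g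
z·-comm Z       g n       k       = refl
z·-comm ⅹ       g zero    zero    = refl
z·-comm ⅹ       g zero    (suc k) = refl
z·-comm ⅹ       g (suc n) zero    = refl
z·-comm ⅹ       g (suc n) (suc k) = refl
z·-comm (K c)   g n k = sym (⟦ Z ⟧-⊡ c g n k)
z·-comm (p ⊕ q) g n k = trans (cong₂ _+_ (z·-comm p g n k) (z·-comm q g n k)) (sym (⟦ Z ⟧-⊞ _ _ n k))
z·-comm (p ⊗ q) g n k = trans (⟦ p ⟧-cong (z·-comm q g) n k) (z·-comm p _ n k)

-- Induction on `q` reduces to generators. `Z` and `K c` are settled by `z·-comm` and homogeneity;
-- `ⅹ` takes a second induction, on `p`.
⟦⟧-comm : ∀ p q g → ⟦ p ⟧ (⟦ q ⟧ g) ≐ ⟦ q ⟧ (⟦ p ⟧ g)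
⟦⟧-comm p Z         g n k = z·-comm p g n k
⟦⟧-comm p (K c)     g n k = ⟦ p ⟧-⊡ c g n k
⟦⟧-comm p (q₁ ⊕ q₂) g n k = trans (⟦ p ⟧-⊞ _ _ n k) (cong₂ _+_ (⟦⟧-comm p q₁ g n k) (⟦⟧-comm p q₂ g n k))
⟦⟧-comm p (q₁ ⊗ q₂) g n k = trans (⟦⟧-comm p q₁ (⟦ q₂ ⟧ g) n k) (⟦ q₁ ⟧-cong (⟦⟧-comm p q₂ g) n k)
⟦⟧-comm Z         ⅹ g n k = sym (z·-comm ⅹ g n k)
⟦⟧-comm ⅹ         ⅹ g n k = refl
⟦⟧-comm (K c)     ⅹ g n k = sym (⟦ ⅹ ⟧-⊡ c g n k)
⟦⟧-comm (p₁ ⊕ p₂) ⅹ g n k = trans (cong₂ _+_ (⟦⟧-comm p₁ ⅹ g n k) (⟦⟧-comm p₂ ⅹ g n k)) (sym (⟦ ⅹ ⟧-⊞ _ _ n k))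
⟦⟧-comm (p₁ ⊗ p₂) ⅹ g n k = trans (⟦ p₁ ⟧-cong (⟦⟧-comm p₂ ⅹ g) n k) (⟦⟧-comm p₁ ⅹ (⟦ p₂ ⟧ g) n k)

-- Powers and truncated exponentials.

unit : Coeffs
unit zero    zero    = 1ℚ
unit zero    (suc k) = 0ℚ
unit (suc n) k       = 0ℚ

power : Op → ℕ → Coeffs
power p zero    = unit
power p (suc m) = ⟦ p ⟧ (power p m)

expPartial : Op → ℕ → Coeffs
expPartial p zero    = 1/ 0 ! ⊡ unit
expPartial p (suc N) = expPartial p N ⊞ 1/ suc N ! ⊡ power p (suc N)

module _ (r : Op) where

  power-order : ∀ {m n} → n ℕ.< m → ∀ k → power (Z ⊗ r) m n k ≡ 0ℚ
  power-order {suc m} {zero}  _         k = refl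
  power-order {suc m} {suc n} (s≤s n<m) k = begin
    -- Vanishing up to degree n is expressed as agreement with `0ℚ ⊡ g`, so that homogeneity of
    -- `⟦ r ⟧` can pull the zero out.
    ⟦ r ⟧ g n k          ≡⟨ ⟦ r ⟧-causal n (λ j≤n k → trans (power-order (ℕ.≤-<-trans j≤n n<m) k) (sym (ℚ.*-zeroˡ (g _ k)))) k ⟩
    ⟦ r ⟧ (0ℚ ⊡ g) n k   ≡⟨ ⟦ r ⟧-⊡ 0ℚ g n k ⟩
    0ℚ * ⟦ r ⟧ g n k     ≡⟨ ℚ.*-zeroˡ (⟦ r ⟧ g n k) ⟩
    0ℚ                   ∎
    where g = power (Z ⊗ r) m

  -- The bound follows the degree, as in `exp`. The exponent is `Z ⊗ r`, whose m-th power starts in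
  -- degree m, so a larger bound adds nothing.
  expCoeffs : Coeffs
  expCoeffs n = expPartial (Z ⊗ r) n n

  expPartial-stable : ∀ {n N} → n ≤ N → ∀ k → expPartial (Z ⊗ r) N n k ≡ expCoeffs n k
  expPartial-stable {N = zero} z≤n k = refl
  expPartial-stable {n} {suc N} n≤1+N k with ℕ.m≤n⇒m<n∨m≡n n≤1+N
  ... | inj₂ refl = refl
  ... | inj₁ n<1+N@(s≤s n≤N) = begin
    expPartial (Z ⊗ r) N n k + c * power (Z ⊗ r) (suc N) n k
      ≡⟨ cong₂ (λ u v → u + c * v) (expPartial-stable n≤N k) (power-order n<1+N k) ⟩
    expCoeffs n k + c * 0ℚ  ≡⟨ solve 2 (λ u c → u :+ c :* con 0ℚ := u) refl (expCoeffs n k) c ⟩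
    expCoeffs n k           ∎
    where c = 1/ suc N !

-- Derivations applied to exponentials.

record IsDerivation (D : Coeffs → Coeffs) : Set where
  field
    D-⊞     : ∀ g h → D (g ⊞ h) ≐ D g ⊞ D h
    D-⊡     : ∀ c g → D (c ⊡ g) ≐ c ⊡ D g
    D-unit  : ∀ n k → D unit n k ≡ 0ℚ

  module _ (p p′ : Op) (leibniz : ∀ g → D (⟦ p ⟧ g) ≐ ⟦ p ⟧ (D g) ⊞ ⟦ p′ ⟧ g) where

    -- The power rule, with `leibniz` as the only instance of the product rule and `p′` in the role
    -- of the derivative of `p`. Commuting `p` past `p′` merges the two summands of the product
    -- rule.
    D-power : ∀ m → D (power p (suc m)) ≐ fromℕ (suc m) ⊡ ⟦ p′ ⟧ (power p m)
    D-power zero n k = begin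
      D (⟦ p ⟧ unit) n k         ≡⟨ leibniz unit n k ⟩
      ⟦ p ⟧ (D unit) n k + d     ≡⟨ cong (_+ d) (⟦ p ⟧-cong (λ n k → trans (D-unit n k) (sym (ℚ.*-zeroˡ (unit n k)))) n k) ⟩
      ⟦ p ⟧ (0ℚ ⊡ unit) n k + d  ≡⟨ cong (_+ d) (⟦ p ⟧-⊡ 0ℚ unit n k) ⟩
      0ℚ * ⟦ p ⟧ unit n k + d    ≡⟨ solve 2 (λ u d → con 0ℚ :* u :+ d := con 1ℚ :* d) refl (⟦ p ⟧ unit n k) d ⟩
      1ℚ * d                     ∎
      where d = ⟦ p′ ⟧ unit n k
    D-power (suc m) n k = begin
      D (⟦ p ⟧ (power p (suc m))) n k          ≡⟨ leibniz _ n k ⟩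
      ⟦ p ⟧ (D (power p (suc m))) n k + d      ≡⟨ cong (_+ d) (⟦ p ⟧-cong (D-power m) n k) ⟩
      ⟦ p ⟧ (c ⊡ ⟦ p′ ⟧ (power p m)) n k + d   ≡⟨ cong (_+ d) (⟦ p ⟧-⊡ c _ n k) ⟩
      c * ⟦ p ⟧ (⟦ p′ ⟧ (power p m)) n k + d   ≡⟨ cong (λ u → c * u + d) (⟦⟧-comm p p′ (power p m) n k) ⟩
      c * d + d                                ≡⟨ solve 2 (λ c d → c :* d :+ d := (con 1ℚ :+ c) :* d) refl c d ⟩
      (1ℚ + c) * d                             ≡⟨ cong (_* d) (fromℕ-suc (suc m)) ⟨
      fromℕ (suc (suc m)) * d                  ∎
      where
      c = fromℕ (suc m)
      d = ⟦ p′ ⟧ (power p (suc m)) n k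

    D-term : ∀ m → D (1/ suc m ! ⊡ power p (suc m)) ≐ ⟦ p′ ⟧ (1/ m ! ⊡ power p m)
    D-term m n k = begin
      D (c ⊡ power p (suc m)) n k       ≡⟨ D-⊡ c _ n k ⟩
      c * D (power p (suc m)) n k       ≡⟨ cong (c *_) (D-power m n k) ⟩
      c * (fromℕ (suc m) * d)           ≡⟨ ℚ.*-assoc c _ d ⟨
      c * fromℕ (suc m) * d             ≡⟨ cong (_* d) (1/[1+n]!*[1+n]≡1/n! m) ⟩
      1/ m ! * d                        ≡⟨ ⟦ p′ ⟧-⊡ (1/ m !) (power p m) n k ⟨
      ⟦ p′ ⟧ (1/ m ! ⊡ power p m) n k   ∎
      where
      c = 1/ suc m !
      d = ⟦ p′ ⟧ (power p m) n k

    -- The constant term dies and every other term becomes `p′` times its predecessor, so the bound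
    -- drops by one and the identity is exact in all degrees.
    D-expPartial : ∀ N → D (expPartial p (suc N)) ≐ ⟦ p′ ⟧ (expPartial p N)
    D-expPartial zero n k = begin
      D (1/ 0 ! ⊡ unit ⊞ 1/ 1 ! ⊡ power p 1) n k  ≡⟨ D-⊞ _ _ n k ⟩
      D (1/ 0 ! ⊡ unit) n k + t                   ≡⟨ cong (_+ t) (D-⊡ (1/ 0 !) unit n k) ⟩
      1/ 0 ! * D unit n k + t                     ≡⟨ cong (λ u → 1/ 0 ! * u + t) (D-unit n k) ⟩
      0ℚ + t                                      ≡⟨ ℚ.+-identityˡ t ⟩
      t                                           ≡⟨ D-term 0 n k ⟩
      ⟦ p′ ⟧ (1/ 0 ! ⊡ unit) n k                  ∎
      where t = D (1/ 1 ! ⊡ power p 1) n k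
    D-expPartial (suc N) n k = begin
      D (expPartial p (suc N) ⊞ _) n k     ≡⟨ D-⊞ _ _ n k ⟩
      D (expPartial p (suc N)) n k + _     ≡⟨ cong₂ _+_ (D-expPartial N n k) (D-term (suc N) n k) ⟩
      ⟦ p′ ⟧ (expPartial p N) n k + _      ≡⟨ ⟦ p′ ⟧-⊞ (expPartial p N) _ n k ⟨
      ⟦ p′ ⟧ (expPartial p (suc N)) n k    ∎

open IsDerivation

∂/∂z ∂/∂x : Coeffs → Coeffs
∂/∂z g n k = fromℕ (suc n) * g (suc n) k
∂/∂x g n k = fromℕ (suc k) * g n (suc k)

z·-∂/∂x : ∀ g → z· ∂/∂x g ≐ ∂/∂x (z· g)
z·-∂/∂x g zero    k = sym (ℚ.*-zeroʳ (fromℕ (suc k)))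
z·-∂/∂x g (suc n) k = refl

∂/∂x-cong : ∀ {g h} → g ≐ h → ∂/∂x g ≐ ∂/∂x h
∂/∂x-cong e n k = cong (fromℕ (suc k) *_) (e n (suc k))

∂/∂z-isDerivation : IsDerivation ∂/∂z
∂/∂z-isDerivation = record
  { D-⊞     = λ g h n k → ℚ.*-distribˡ-+ (fromℕ (suc n)) _ _
  ; D-⊡     = λ c g n k → *-exchange (fromℕ (suc n)) c _
  ; D-unit  = λ n k → ℚ.*-zeroʳ (fromℕ (suc n))
  }

∂/∂x-isDerivation : IsDerivation ∂/∂x
∂/∂x-isDerivation = record
  { D-⊞     = λ g h n k → ℚ.*-distribˡ-+ (fromℕ (suc k)) _ _
  ; D-⊡     = λ c g n k → *-exchange (fromℕ (suc k)) c _
  ; D-unit  = λ { zero k → ℚ.*-zeroʳ (fromℕ (suc k)) ; (suc n) k → ℚ.*-zeroʳ (fromℕ (suc k)) }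
  }

module _ (r p′ : Op) where

  -- In degree n, `∂/∂z` reads degree n + 1, where the bound is already n + 1, so `D-expPartial`
  -- applies directly.
  ∂/∂z-exp : (∀ g → ∂/∂z (⟦ Z ⊗ r ⟧ g) ≐ ⟦ Z ⊗ r ⟧ (∂/∂z g) ⊞ ⟦ p′ ⟧ g) →
             ∂/∂z (expCoeffs r) ≐ ⟦ p′ ⟧ (expCoeffs r)
  ∂/∂z-exp leibniz n k = trans
    (D-expPartial ∂/∂z-isDerivation (Z ⊗ r) p′ leibniz n n k)
    (⟦ p′ ⟧-causal n (expPartial-stable r) k)

  ∂/∂x-exp : (∀ g → ∂/∂x (⟦ Z ⊗ r ⟧ g) ≐ ⟦ Z ⊗ r ⟧ (∂/∂x g) ⊞ ⟦ p′ ⟧ g) →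
             ∂/∂x (expCoeffs r) ≐ ⟦ p′ ⟧ (expCoeffs r)
  ∂/∂x-exp leibniz n k = begin
    -- `∂/∂x` keeps the z-degree, so the bound must first be raised from n to n + 1 to leave room
    -- for the drop.
    ∂/∂x (expCoeffs r) n k                   ≡⟨ cong (fromℕ (suc k) *_) (expPartial-stable r (ℕ.n≤1+n n) (suc k)) ⟨
    ∂/∂x (expPartial (Z ⊗ r) (suc n)) n k    ≡⟨ D-expPartial ∂/∂x-isDerivation (Z ⊗ r) p′ leibniz n n k ⟩
    ⟦ p′ ⟧ (expPartial (Z ⊗ r) n) n k        ≡⟨ ⟦ p′ ⟧-causal n (expPartial-stable r) k ⟩
    ⟦ p′ ⟧ (expCoeffs r) n k                 ∎

-- The given exponent and the recurrence for its exponential.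

-- The exponent xz + αz² + βz⁴ is Z ⊗ cofactor α β, and its z-derivative ⅹ ⊕ x-free′.
module _ (α β : ℚ) where

  x-free : Op
  x-free = Z ⊗ K α ⊕ Z ⊗ (Z ⊗ (Z ⊗ K β))

  x-free′ : Op
  x-free′ = Z ⊗ K (fromℕ 2 * α) ⊕ Z ⊗ (Z ⊗ (Z ⊗ K (fromℕ 4 * β)))

  cofactor : Op
  cofactor = ⅹ ⊕ x-free

  -- αz + βz³ is constant in x, so ∂/∂x passes through it. The split on the degree lets the shifts
  -- by z and z³ compute.
  x-free-x : ∀ g n k → fromℕ (suc k) * ⟦ x-free ⟧ g n (suc k) ≡ ⟦ x-free ⟧ (∂/∂x g) n k
  x-free-x g zero k = ℚ.*-zeroʳ (fromℕ (suc k))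
  x-free-x g (suc zero) k =
    solve 3 (λ c α u → c :* (α :* u :+ con 0ℚ) := α :* (c :* u) :+ con 0ℚ) refl (fromℕ (suc k)) α _
  x-free-x g (suc (suc zero)) k =
    solve 3 (λ c α u → c :* (α :* u :+ con 0ℚ) := α :* (c :* u) :+ con 0ℚ) refl (fromℕ (suc k)) α _
  x-free-x g (suc (suc (suc n))) k =
    solve 5 (λ c α β u v → c :* (α :* u :+ β :* v) := α :* (c :* u) :+ β :* (c :* v)) refl (fromℕ (suc k)) α β _ _

  leibniz-x : ∀ g → ∂/∂x (⟦ Z ⊗ cofactor ⟧ g) ≐ ⟦ Z ⊗ cofactor ⟧ (∂/∂x g) ⊞ ⟦ Z ⟧ g
  leibniz-x g zero    k = ℚ.*-zeroʳ (fromℕ (suc k))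
  leibniz-x g (suc n) k = begin
    c * (g n k + ⟦ x-free ⟧ g n (suc k))     ≡⟨ ℚ.*-distribˡ-+ c _ _ ⟩
    c * g n k + c * ⟦ x-free ⟧ g n (suc k)   ≡⟨ cong₂ _+_ (x-rule k) (x-free-x g n k) ⟩
    (x· ∂/∂x g) n k + g n k + b                ≡⟨ solve 3 (λ u v b → u :+ v :+ b := u :+ b :+ v) refl ((x· ∂/∂x g) n k) (g n k) b ⟩
    (x· ∂/∂x g) n k + b + g n k                ∎
    where
    c = fromℕ (suc k)
    b = ⟦ x-free ⟧ (∂/∂x g) n k
    -- This is ∂(xg)/∂x = x ∂g/∂x + g on coefficients; its last term yields the `Z` in the product
    -- rule.
    x-rule : ∀ k → fromℕ (suc k) * g n k ≡ (x· ∂/∂x g) n k + g n k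
    x-rule zero    = solve 1 (λ u → con 1ℚ :* u := con 0ℚ :+ u) refl (g n 0)
    x-rule (suc k) = trans (cong (_* g n (suc k)) (fromℕ-suc (suc k)))
      (solve 2 (λ c u → (con 1ℚ :+ c) :* u := c :* u :+ u) refl (fromℕ (suc k)) _)

  -- The product rule for αz² + βz⁴ in degree n + 1. One factor z has been cancelled, which is why
  -- the weight n + 2 stands before a coefficient of degree n + 1.
  x-free-z : ∀ g n k → fromℕ (suc (suc n)) * ⟦ x-free ⟧ g (suc n) k ≡
                         ⟦ x-free ⟧ (∂/∂z g) n k + ⟦ x-free′ ⟧ g (suc n) k
  x-free-z g zero k =
    solve 2 (λ α u → con (fromℕ 2) :* (α :* u :+ con 0ℚ) := con 0ℚ :+ con 0ℚ :+ (con (fromℕ 2) :* α :* u :+ con 0ℚ)) refl α _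
  x-free-z g (suc zero) k =
    solve 2 (λ α u → con (fromℕ 3) :* (α :* u :+ con 0ℚ) :=
                     α :* (con (fromℕ 1) :* u) :+ con 0ℚ :+ (con (fromℕ 2) :* α :* u :+ con 0ℚ)) refl α _
  x-free-z g (suc (suc zero)) k =
    solve 4 (λ α β u v → con (fromℕ 4) :* (α :* u :+ β :* v) :=
                         α :* (con (fromℕ 2) :* u) :+ con 0ℚ :+ (con (fromℕ 2) :* α :* u :+ con (fromℕ 4) :* β :* v)) refl α β _ _
  x-free-z g (suc (suc (suc n))) k = begin
    fromℕ (5 ℕ.+ n) * (α * u + β * v)  ≡⟨ cong (_* (α * u + β * v)) (fromℤ-homo-+ (+ 2) (+ (3 ℕ.+ n))) ⟩
    (fromℕ 2 + c₃) * (α * u + β * v)   ≡⟨ solve 5 (λ c α β u v → (con (fromℕ 2) :+ c) :* (α :* u :+ β :* v) :=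
                                            α :* (c :* u) :+ β :* ((con (fromℕ 2) :+ c) :* v) :+ con (fromℕ 2) :* α :* u) refl c₃ α β u v ⟩
    α * (c₃ * u) + β * ((fromℕ 2 + c₃) * v) + fromℕ 2 * α * u
      ≡⟨ cong (λ w → α * (c₃ * u) + β * (w * v) + fromℕ 2 * α * u) 2+c₃≡4+c₁ ⟩
    α * (c₃ * u) + β * ((fromℕ 4 + c₁) * v) + fromℕ 2 * α * u
      ≡⟨ solve 6 (λ c d α β u v → α :* (c :* u) :+ β :* ((con (fromℕ 4) :+ d) :* v) :+ con (fromℕ 2) :* α :* u :=
           α :* (c :* u) :+ β :* (d :* v) :+ (con (fromℕ 2) :* α :* u :+ con (fromℕ 4) :* β :* v)) refl c₃ c₁ α β u v ⟩
    α * (c₃ * u) + β * (c₁ * v) + (fromℕ 2 * α * u + fromℕ 4 * β * v)  ∎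
    where
    u = g (3 ℕ.+ n) k
    v = g (1 ℕ.+ n) k
    c₃ = fromℕ (3 ℕ.+ n)
    c₁ = fromℕ (1 ℕ.+ n)
    -- The weight n + 5 is the exponent of z plus the degree read from g: 2 + (n + 3) at αz², and 4
    -- + (n + 1) at βz⁴.
    2+c₃≡4+c₁ : fromℕ 2 + c₃ ≡ fromℕ 4 + c₁
    2+c₃≡4+c₁ = trans (sym (fromℤ-homo-+ (+ 2) (+ (3 ℕ.+ n)))) (fromℤ-homo-+ (+ 4) (+ (1 ℕ.+ n)))

  leibniz-z : ∀ g → ∂/∂z (⟦ Z ⊗ cofactor ⟧ g) ≐ ⟦ Z ⊗ cofactor ⟧ (∂/∂z g) ⊞ ⟦ ⅹ ⊕ x-free′ ⟧ g
  leibniz-z g zero    k = solve 1 (λ u → con 1ℚ :* (u :+ con 0ℚ) := con 0ℚ :+ (u :+ con 0ℚ)) refl ((x· g) 0 k)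
  leibniz-z g (suc n) k = begin
    c * ((x· g) (suc n) k + ⟦ x-free ⟧ g (suc n) k)     ≡⟨ ℚ.*-distribˡ-+ c _ _ ⟩
    c * (x· g) (suc n) k + c * ⟦ x-free ⟧ g (suc n) k   ≡⟨ cong₂ _+_ (x-rule k) (x-free-z g n k) ⟩
    ((x· ∂/∂z g) n k + (x· g) (suc n) k) + (⟦ x-free ⟧ (∂/∂z g) n k + ⟦ x-free′ ⟧ g (suc n) k)
      ≡⟨ +-interchange ((x· ∂/∂z g) n k) ((x· g) (suc n) k) (⟦ x-free ⟧ (∂/∂z g) n k) (⟦ x-free′ ⟧ g (suc n) k) ⟩
    ⟦ cofactor ⟧ (∂/∂z g) n k + ⟦ ⅹ ⊕ x-free′ ⟧ g (suc n) k ∎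
    where
    c = fromℕ (suc (suc n))
    x-rule : ∀ k → c * (x· g) (suc n) k ≡ (x· ∂/∂z g) n k + (x· g) (suc n) k
    x-rule zero    = ℚ.*-zeroʳ c
    x-rule (suc k) = trans (cong (_* g (suc n) k) (fromℕ-suc (suc n)))
      (solve 2 (λ c u → (con 1ℚ :+ c) :* u := c :* u :+ u) refl (fromℕ (suc n)) _)

  private
    E = expCoeffs cofactor

  z·-exp : z· E ≐ ∂/∂x E
  z·-exp n k = sym (∂/∂x-exp cofactor Z leibniz-x n k)

  z·z·-exp : z· z· E ≐ ∂/∂x (∂/∂x E)
  z·z·-exp n k = begin
    (z· z· E) n k       ≡⟨ ⟦ Z ⟧-cong z·-exp n k ⟩
    (z· ∂/∂x E) n k     ≡⟨ z·-∂/∂x E n k ⟩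
    ∂/∂x (z· E) n k     ≡⟨ ∂/∂x-cong z·-exp n k ⟩
    ∂/∂x (∂/∂x E) n k   ∎

  z·z·z·-exp : z· z· z· E ≐ ∂/∂x (∂/∂x (∂/∂x E))
  z·z·z·-exp n k = begin
    (z· z· z· E) n k           ≡⟨ ⟦ Z ⟧-cong z·z·-exp n k ⟩
    (z· ∂/∂x (∂/∂x E)) n k     ≡⟨ z·-∂/∂x (∂/∂x E) n k ⟩
    ∂/∂x (z· ∂/∂x E) n k       ≡⟨ ∂/∂x-cong (z·-∂/∂x E) n k ⟩
    ∂/∂x (∂/∂x (z· E)) n k     ≡⟨ ∂/∂x-cong (∂/∂x-cong z·-exp) n k ⟩
    ∂/∂x (∂/∂x (∂/∂x E)) n k   ∎

  exp-recurrence : ∀ n k → fromℕ (suc n) * E (suc n) k ≡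
    (x· E) n k + (fromℕ 2 * α * ∂/∂x E n k + fromℕ 4 * β * ∂/∂x (∂/∂x (∂/∂x E)) n k)
  exp-recurrence n k = begin
    ∂/∂z E n k                                                     ≡⟨ ∂/∂z-exp cofactor (ⅹ ⊕ x-free′) leibniz-z n k ⟩
    (x· E) n k + ((z· a ⊡ E) n k + (z· z· z· b ⊡ E) n k)           ≡⟨ cong₂ (λ u v → (x· E) n k + (u + v)) (⟦ Z ⟧-⊡ a E n k) (⟦ Z ⊗ Z ⊗ Z ⟧-⊡ b E n k) ⟩
    (x· E) n k + (a * (z· E) n k + b * (z· z· z· E) n k)           ≡⟨ cong₂ (λ u v → (x· E) n k + (a * u + b * v)) (z·-exp n k) (z·z·z·-exp n k) ⟩
    (x· E) n k + (a * ∂/∂x E n k + b * ∂/∂x (∂/∂x (∂/∂x E)) n k)   ∎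
    where
    a = fromℕ 2 * α
    b = fromℕ 4 * β

-- From list polynomials and convolutions to coefficient arrays.

coeff-+ₚ : ∀ p q k → [x^ k ] (p +ₚ q) ≡ [x^ k ] p + [x^ k ] q
coeff-+ₚ []      q       k       = sym (ℚ.+-identityˡ _)
coeff-+ₚ (c ∷ p) []      k       = sym (ℚ.+-identityʳ _)
coeff-+ₚ (c ∷ p) (d ∷ q) zero    = refl
coeff-+ₚ (c ∷ p) (d ∷ q) (suc k) = coeff-+ₚ p q k

coeff-·ₚ : ∀ c p k → [x^ k ] (c ·ₚ p) ≡ c * [x^ k ] p
coeff-·ₚ c []      k       = sym (ℚ.*-zeroʳ c)
coeff-·ₚ c (d ∷ p) zero    = refl
coeff-·ₚ c (d ∷ p) (suc k) = coeff-·ₚ c p k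

coeff-0∷[] : ∀ k → [x^ k ] (0ℚ ∷ []) ≡ 0ℚ
coeff-0∷[] zero    = refl
coeff-0∷[] (suc k) = refl

coeff-const* : ∀ c p k → [x^ k ] (constₚ c *ₚ p) ≡ c * [x^ k ] p
coeff-const* c p k = begin
  [x^ k ] (c ·ₚ p +ₚ (0ℚ ∷ []))            ≡⟨ coeff-+ₚ (c ·ₚ p) _ k ⟩
  [x^ k ] (c ·ₚ p) + [x^ k ] (0ℚ ∷ [])     ≡⟨ cong₂ _+_ (coeff-·ₚ c p k) (coeff-0∷[] k) ⟩
  c * [x^ k ] p + 0ℚ                       ≡⟨ ℚ.+-identityʳ _ ⟩
  c * [x^ k ] p                            ∎

coeffs : Series → Coeffs
coeffs f n k = [x^ k ] f n

coeff-X* : ∀ f n k → [x^ k ] (X *ₚ f n) ≡ (x· coeffs f) n k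
coeff-X* f n k = begin
  [x^ k ] (0ℚ ·ₚ f n +ₚ (0ℚ ∷ constₚ 1ℚ *ₚ f n))            ≡⟨ coeff-+ₚ (0ℚ ·ₚ f n) _ k ⟩
  [x^ k ] (0ℚ ·ₚ f n) + [x^ k ] (0ℚ ∷ constₚ 1ℚ *ₚ f n)     ≡⟨ cong₂ _+_ (trans (coeff-·ₚ 0ℚ (f n) k) (ℚ.*-zeroˡ ([x^ k ] f n))) (shift k) ⟩
  0ℚ + (x· coeffs f) n k                                    ≡⟨ ℚ.+-identityˡ _ ⟩
  (x· coeffs f) n k                                         ∎
  where
  shift : ∀ k → [x^ k ] (0ℚ ∷ constₚ 1ℚ *ₚ f n) ≡ (x· coeffs f) n k
  shift zero    = refl
  shift (suc k) = trans (coeff-const* 1ℚ (f n) k) (ℚ.*-identityˡ _)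

Σₚ≤-truncate : ∀ m h → (∀ i → h (suc m ℕ.+ i) ≡ []) → ∀ j k → [x^ k ] Σₚ≤ (j ℕ.+ m) h ≡ [x^ k ] Σₚ≤ m h
Σₚ≤-truncate m h h≡[] zero    k = refl
Σₚ≤-truncate m h h≡[] (suc j) k = begin
  [x^ k ] (Σₚ≤ (j ℕ.+ m) h +ₚ h (suc (j ℕ.+ m)))        ≡⟨ coeff-+ₚ (Σₚ≤ (j ℕ.+ m) h) _ k ⟩
  [x^ k ] Σₚ≤ (j ℕ.+ m) h + [x^ k ] h (suc (j ℕ.+ m))   ≡⟨ cong₂ _+_ (Σₚ≤-truncate m h h≡[] j k) (cong [x^ k ]_ (trans (cong (λ i → h (suc i)) (ℕ.+-comm j m)) (h≡[] j))) ⟩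
  [x^ k ] Σₚ≤ m h + 0ℚ                                  ≡⟨ ℚ.+-identityʳ _ ⟩
  [x^ k ] Σₚ≤ m h                                       ∎

module _ (a b : ℤ) where

  private
    f = exponent a b
    α = fromℤ a
    β = fromℤ b

  -- The exponent lives in z-degrees 1, 2 and 4, so at most three terms of the convolution survive.
  -- Below degree 4 the convolution stops early and is computed by hand; from there on
  -- `Σₚ≤-truncate` removes the tail.
  coeff-exponent* : ∀ g → coeffs (f *ₛ g) ≐ ⟦ Z ⊗ cofactor α β ⟧ (coeffs g)
  coeff-exponent* g zero k = refl
  coeff-exponent* g (suc zero) k = trans (coeff-X* g 0 k) (sym (ℚ.+-identityʳ _))
  coeff-exponent* g (suc (suc zero)) k = begin
    [x^ k ] (X *ₚ g 1 +ₚ constₚ α *ₚ g 0)               ≡⟨ coeff-+ₚ (X *ₚ g 1) _ k ⟩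
    [x^ k ] (X *ₚ g 1) + [x^ k ] (constₚ α *ₚ g 0)      ≡⟨ cong₂ _+_ (coeff-X* g 1 k) (trans (coeff-const* α (g 0) k) (sym (ℚ.+-identityʳ _))) ⟩
    (x· coeffs g) 1 k + (α * [x^ k ] g 0 + 0ℚ)          ∎
  coeff-exponent* g (suc (suc (suc zero))) k = begin
    [x^ k ] (X *ₚ g 2 +ₚ constₚ α *ₚ g 1 +ₚ [])         ≡⟨ coeff-+ₚ (X *ₚ g 2 +ₚ constₚ α *ₚ g 1) [] k ⟩
    [x^ k ] (X *ₚ g 2 +ₚ constₚ α *ₚ g 1) + 0ℚ          ≡⟨ cong (_+ 0ℚ) (coeff-+ₚ (X *ₚ g 2) _ k) ⟩
    [x^ k ] (X *ₚ g 2) + [x^ k ] (constₚ α *ₚ g 1) + 0ℚ ≡⟨ cong (_+ 0ℚ) (cong₂ _+_ (coeff-X* g 2 k) (coeff-const* α (g 1) k)) ⟩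
    (x· coeffs g) 2 k + α * [x^ k ] g 1 + 0ℚ            ≡⟨ ℚ.+-assoc ((x· coeffs g) 2 k) _ 0ℚ ⟩
    (x· coeffs g) 2 k + (α * [x^ k ] g 1 + 0ℚ)          ∎
  coeff-exponent* g (suc (suc (suc (suc n)))) k = begin
    [x^ k ] Σₚ≤ (4 ℕ.+ n) h                     ≡⟨ cong (λ i → [x^ k ] Σₚ≤ i h) (ℕ.+-comm 4 n) ⟩
    [x^ k ] Σₚ≤ (n ℕ.+ 4) h                     ≡⟨ Σₚ≤-truncate 4 h (λ _ → refl) n k ⟩
    [x^ k ] (h 1 +ₚ h 2 +ₚ [] +ₚ h 4)           ≡⟨ coeff-+ₚ (h 1 +ₚ h 2 +ₚ []) (h 4) k ⟩
    [x^ k ] (h 1 +ₚ h 2 +ₚ []) + [x^ k ] h 4    ≡⟨ cong (_+ [x^ k ] h 4) (coeff-+ₚ (h 1 +ₚ h 2) [] k) ⟩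
    [x^ k ] (h 1 +ₚ h 2) + 0ℚ + [x^ k ] h 4     ≡⟨ cong (λ u → u + 0ℚ + [x^ k ] h 4) (coeff-+ₚ (h 1) (h 2) k) ⟩
    [x^ k ] h 1 + [x^ k ] h 2 + 0ℚ + [x^ k ] h 4
      ≡⟨ solve 3 (λ u v w → u :+ v :+ con 0ℚ :+ w := u :+ (v :+ w)) refl ([x^ k ] h 1) ([x^ k ] h 2) ([x^ k ] h 4) ⟩
    [x^ k ] h 1 + ([x^ k ] h 2 + [x^ k ] h 4)
      ≡⟨ cong₂ _+_ (coeff-X* g (3 ℕ.+ n) k) (cong₂ _+_ (coeff-const* α (g (2 ℕ.+ n)) k) (coeff-const* β (g n) k)) ⟩
    (x· coeffs g) (3 ℕ.+ n) k + (α * [x^ k ] g (2 ℕ.+ n) + β * [x^ k ] g n)  ∎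
    where
    h : ℕ → Poly
    h i = f i *ₚ g (4 ℕ.+ n ℕ.∸ i)

  coeff-exponent^ : ∀ m → coeffs (f ^ₛ m) ≐ power (Z ⊗ cofactor α β) m
  coeff-exponent^ zero    zero    zero    = refl
  coeff-exponent^ zero    zero    (suc k) = refl
  coeff-exponent^ zero    (suc n) k       = refl
  coeff-exponent^ (suc m) n k = trans
    (coeff-exponent* (f ^ₛ m) n k)
    (⟦ Z ⊗ cofactor α β ⟧-cong (coeff-exponent^ m) n k)

  coeff-exp : coeffs (exp f (exponent₀≈0 a b)) ≐ expCoeffs (cofactor α β)
  coeff-exp n k = partial n
    where
    term : ∀ m → [x^ k ] (1/ m ! ·ₚ (f ^ₛ m) n) ≡ 1/ m ! * power (Z ⊗ cofactor α β) m n k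
    term m = trans (coeff-·ₚ (1/ m !) ((f ^ₛ m) n) k) (cong (1/ m ! *_) (coeff-exponent^ m n k))
    partial : ∀ N → [x^ k ] Σₚ≤ N (λ m → 1/ m ! ·ₚ (f ^ₛ m) n) ≡ expPartial (Z ⊗ cofactor α β) N n k
    partial zero    = term 0
    partial (suc N) = trans
      (coeff-+ₚ (Σₚ≤ N (λ m → 1/ m ! ·ₚ (f ^ₛ m) n)) _ k)
      (cong₂ _+_ (partial N) (term (suc N)))

  coeff-egf : ∀ P → egf P ≈ₛ exp f (exponent₀≈0 a b) →
              ∀ n k → [x^ k ] P n ≡ fromℕ (n !) * expCoeffs (cofactor α β) n k
  coeff-egf P egf≈exp n k = begin
    c                                          ≡⟨ ℚ.*-identityˡ c ⟨
    1ℚ * c                                     ≡⟨ cong (_* c) (1/n!*n!≡1 n) ⟨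
    1/ n ! * fromℕ (n !) * c                   ≡⟨ solve 3 (λ r s c → r :* s :* c := s :* (r :* c)) refl (1/ n !) (fromℕ (n !)) c ⟩
    fromℕ (n !) * (1/ n ! * c)                 ≡⟨ cong (fromℕ (n !) *_) (coeff-·ₚ (1/ n !) (P n) k) ⟨
    fromℕ (n !) * [x^ k ] egf P n              ≡⟨ cong (fromℕ (n !) *_) (trans (egf≈exp n k) (coeff-exp n k)) ⟩
    fromℕ (n !) * expCoeffs (cofactor α β) n k ∎
    where c = [x^ k ] P n

-- Binomial coefficients as falling products.

2*[2+k]C2 : ∀ k → 2 ℕ.* ((2 ℕ.+ k) C 2) ≡ (1 ℕ.+ k) ℕ.* (2 ℕ.+ k)
2*[2+k]C2 zero    = refl
2*[2+k]C2 (suc k) = begin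
  2 ℕ.* ((3 ℕ.+ k) C 2)                           ≡⟨ cong (2 ℕ.*_) (nCk+nC[k+1]≡[n+1]C[k+1] (2 ℕ.+ k) 1) ⟨
  2 ℕ.* ((2 ℕ.+ k) C 1 ℕ.+ (2 ℕ.+ k) C 2)         ≡⟨ ℕ.*-distribˡ-+ 2 ((2 ℕ.+ k) C 1) ((2 ℕ.+ k) C 2) ⟩
  2 ℕ.* ((2 ℕ.+ k) C 1) ℕ.+ 2 ℕ.* ((2 ℕ.+ k) C 2) ≡⟨ cong₂ ℕ._+_ (cong (2 ℕ.*_) (nC1≡n (2 ℕ.+ k))) (2*[2+k]C2 k) ⟩
  2 ℕ.* (2 ℕ.+ k) ℕ.+ (1 ℕ.+ k) ℕ.* (2 ℕ.+ k)     ≡⟨ ℕ.solve (k ∷ []) ⟩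
  (2 ℕ.+ k) ℕ.* (3 ℕ.+ k)                         ∎

-- Three derivatives of x^(k+3) leave (k+1)(k+2)(k+3), which is 3! times the binomial; with the 4
-- from differentiating z⁴ this gives the 24 of the rule. Cleared of division, Pascal's rule makes
-- the induction step a polynomial identity.
6*[3+k]C3 : ∀ k → 6 ℕ.* ((3 ℕ.+ k) C 3) ≡ (1 ℕ.+ k) ℕ.* ((2 ℕ.+ k) ℕ.* (3 ℕ.+ k))
6*[3+k]C3 zero    = refl
6*[3+k]C3 (suc k) = begin
  6 ℕ.* ((4 ℕ.+ k) C 3)                           ≡⟨ cong (6 ℕ.*_) (nCk+nC[k+1]≡[n+1]C[k+1] (3 ℕ.+ k) 2) ⟨
  6 ℕ.* ((3 ℕ.+ k) C 2 ℕ.+ (3 ℕ.+ k) C 3)         ≡⟨ split ((3 ℕ.+ k) C 2) ((3 ℕ.+ k) C 3) ⟩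
  3 ℕ.* (2 ℕ.* ((3 ℕ.+ k) C 2)) ℕ.+ 6 ℕ.* ((3 ℕ.+ k) C 3)
                                                  ≡⟨ cong₂ (λ u v → 3 ℕ.* u ℕ.+ v) (2*[2+k]C2 (suc k)) (6*[3+k]C3 k) ⟩
  3 ℕ.* ((2 ℕ.+ k) ℕ.* (3 ℕ.+ k)) ℕ.+ (1 ℕ.+ k) ℕ.* ((2 ℕ.+ k) ℕ.* (3 ℕ.+ k))
                                                  ≡⟨ ℕ.solve (k ∷ []) ⟩
  (2 ℕ.+ k) ℕ.* ((3 ℕ.+ k) ℕ.* (4 ℕ.+ k))         ∎
  where
  split : ∀ u v → 6 ℕ.* (u ℕ.+ v) ≡ 3 ℕ.* (2 ℕ.* u) ℕ.+ 6 ℕ.* v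
  split = ℕ.solve-∀

-- Kronecker deltas and signed counts of labels.

δ : ℕ → ℕ → ℤ
δ zero    zero    = + 1
δ zero    (suc k) = 0ℤ
δ (suc j) zero    = 0ℤ
δ (suc j) (suc k) = δ j k

δ-refl : ∀ k → δ k k ≡ + 1
δ-refl zero    = refl
δ-refl (suc k) = δ-refl k

δ-≢ : ∀ {j k} → j ≢ k → δ j k ≡ 0ℤ
δ-≢ {zero}  {zero}  j≢k with () ← j≢k refl
δ-≢ {zero}  {suc k} j≢k = refl
δ-≢ {suc j} {zero}  j≢k = refl
δ-≢ {suc j} {suc k} j≢k = δ-≢ λ j≡k → j≢k (cong suc j≡k)

-- Off the diagonal both sides vanish. It turns a multiplicity given by the parent's label into a
-- weight given by the target index.
δ-replace : ∀ (f : ℕ → ℤ) j k → f j ℤ.* δ j k ≡ f k ℤ.* δ j k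
δ-replace f zero    zero    = refl
δ-replace f zero    (suc k) = trans (ℤ.*-zeroʳ (f 0)) (sym (ℤ.*-zeroʳ (f (suc k))))
δ-replace f (suc j) zero    = trans (ℤ.*-zeroʳ (f (suc j))) (sym (ℤ.*-zeroʳ (f 0)))
δ-replace f (suc j) (suc k) = δ-replace (λ i → f (suc i)) j k

δ-∸1 : ∀ j k → + j ℤ.* δ (j ℕ.∸ 1) k ≡ + suc k ℤ.* δ j (suc k)
δ-∸1 zero    k = sym (ℤ.*-zeroʳ (+ suc k))
δ-∸1 (suc j) k = δ-replace (λ i → + suc i) j k

-- For j < 3 the subtraction truncates, but the binomial is zero; otherwise `δ-replace` applies.
δ-∸3 : ∀ j k → + (j C 3) ℤ.* δ (j ℕ.∸ 3) k ≡ + ((3 ℕ.+ k) C 3) ℤ.* δ j (3 ℕ.+ k)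
δ-∸3 zero                k = sym (ℤ.*-zeroʳ (+ ((3 ℕ.+ k) C 3)))
δ-∸3 (suc zero)          k = sym (ℤ.*-zeroʳ (+ ((3 ℕ.+ k) C 3)))
δ-∸3 (suc (suc zero))    k = sym (ℤ.*-zeroʳ (+ ((3 ℕ.+ k) C 3)))
δ-∸3 (suc (suc (suc j))) k = δ-replace (λ i → + ((3 ℕ.+ i) C 3)) j k

count : Label → List Label → ℕ
count l ls = length (filter (_≟ l) ls)

count-≡ : ∀ l ls → count l (l ∷ ls) ≡ suc (count l ls)
count-≡ l ls = cong length (filter-accept (_≟ l) refl)

count-≢ : ∀ {l l′} ls → l′ ≢ l → count l (l′ ∷ ls) ≡ count l ls
count-≢ {l} ls l′≢l = cong length (filter-reject (_≟ l) l′≢l)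

signedCount : ℕ → List Label → ℤ
signedCount k ls = + count ⟨ k ⟩ ls - + count ⟨ k ⟩‾ ls

-- A node read as the coefficient sequence of x^j, or of -x^j if marked.
weight : Label → ℕ → ℤ
weight ⟨ j ⟩  k = δ j k
weight ⟨ j ⟩‾ k = - δ j k

signedCount-∷ : ∀ k l ls → signedCount k (l ∷ ls) ≡ weight l k ℤ.+ signedCount k ls
signedCount-∷ k ⟨ j ⟩ ls = cases (j ℕ.≟ k)
  where
  cases : Dec (j ≡ k) → signedCount k (⟨ j ⟩ ∷ ls) ≡ δ j k ℤ.+ signedCount k ls
  cases (yes refl) = begin
    + count ⟨ k ⟩ (⟨ k ⟩ ∷ ls) - + count ⟨ k ⟩‾ (⟨ k ⟩ ∷ ls) ≡⟨ cong (λ m → + m - + count ⟨ k ⟩‾ ls) (count-≡ ⟨ k ⟩ ls) ⟩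
    + 1 ℤ.+ + count ⟨ k ⟩ ls - + count ⟨ k ⟩‾ ls             ≡⟨ ℤ.+-assoc (+ 1) (+ count ⟨ k ⟩ ls) (- + count ⟨ k ⟩‾ ls) ⟩
    + 1 ℤ.+ signedCount k ls                                 ≡⟨ cong (ℤ._+ signedCount k ls) (δ-refl k) ⟨
    δ k k ℤ.+ signedCount k ls                               ∎
  cases (no j≢k) = begin
    + count ⟨ k ⟩ (⟨ j ⟩ ∷ ls) - + count ⟨ k ⟩‾ (⟨ j ⟩ ∷ ls) ≡⟨ cong (λ m → + m - + count ⟨ k ⟩‾ ls) (count-≢ {⟨ k ⟩} {⟨ j ⟩} ls λ { refl → j≢k refl }) ⟩
    signedCount k ls                                         ≡⟨ ℤ.+-identityˡ _ ⟨
    0ℤ ℤ.+ signedCount k ls                                  ≡⟨ cong (ℤ._+ signedCount k ls) (δ-≢ j≢k) ⟨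
    δ j k ℤ.+ signedCount k ls                               ∎
signedCount-∷ k ⟨ j ⟩‾ ls = cases (j ℕ.≟ k)
  where
  regroup : ∀ u v w → u - (v ℤ.+ w) ≡ - v ℤ.+ (u - w)
  regroup = ℤ.solve-∀
  cases : Dec (j ≡ k) → signedCount k (⟨ j ⟩‾ ∷ ls) ≡ - δ j k ℤ.+ signedCount k ls
  cases (yes refl) = begin
    + count ⟨ k ⟩ (⟨ k ⟩‾ ∷ ls) - + count ⟨ k ⟩‾ (⟨ k ⟩‾ ∷ ls) ≡⟨ cong (λ n → + count ⟨ k ⟩ ls - + n) (count-≡ ⟨ k ⟩‾ ls) ⟩
    + count ⟨ k ⟩ ls - (+ 1 ℤ.+ + count ⟨ k ⟩‾ ls)             ≡⟨ regroup (+ count ⟨ k ⟩ ls) (+ 1) (+ count ⟨ k ⟩‾ ls) ⟩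
    - (+ 1) ℤ.+ signedCount k ls                               ≡⟨ cong (λ u → - u ℤ.+ signedCount k ls) (δ-refl k) ⟨
    - δ k k ℤ.+ signedCount k ls                               ∎
  cases (no j≢k) = begin
    + count ⟨ k ⟩ (⟨ j ⟩‾ ∷ ls) - + count ⟨ k ⟩‾ (⟨ j ⟩‾ ∷ ls) ≡⟨ cong (λ n → + count ⟨ k ⟩ ls - + n) (count-≢ {⟨ k ⟩‾} {⟨ j ⟩‾} ls λ { refl → j≢k refl }) ⟩
    signedCount k ls                                           ≡⟨ ℤ.+-identityˡ _ ⟨
    0ℤ ℤ.+ signedCount k ls                                    ≡⟨ cong (λ u → - u ℤ.+ signedCount k ls) (δ-≢ j≢k) ⟨
    - δ j k ℤ.+ signedCount k ls                               ∎

signedCount-++ : ∀ k ls ms → signedCount k (ls ++ ms) ≡ signedCount k ls ℤ.+ signedCount k ms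
signedCount-++ k []       ms = sym (ℤ.+-identityˡ _)
signedCount-++ k (l ∷ ls) ms = begin
  signedCount k (l ∷ ls ++ ms)                                  ≡⟨ signedCount-∷ k l (ls ++ ms) ⟩
  weight l k ℤ.+ signedCount k (ls ++ ms)                       ≡⟨ cong (ℤ._+_ (weight l k)) (signedCount-++ k ls ms) ⟩
  weight l k ℤ.+ (signedCount k ls ℤ.+ signedCount k ms)        ≡⟨ ℤ.+-assoc (weight l k) _ _ ⟨
  weight l k ℤ.+ signedCount k ls ℤ.+ signedCount k ms          ≡⟨ cong (ℤ._+ signedCount k ms) (signedCount-∷ k l ls) ⟨
  signedCount k (l ∷ ls) ℤ.+ signedCount k ms                   ∎

signedCount-replicate : ∀ k m l → signedCount k (replicate m l) ≡ + m ℤ.* weight l k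
signedCount-replicate k zero    l = refl
signedCount-replicate k (suc m) l = begin
  signedCount k (l ∷ replicate m l)              ≡⟨ signedCount-∷ k l (replicate m l) ⟩
  weight l k ℤ.+ signedCount k (replicate m l)   ≡⟨ cong (ℤ._+_ (weight l k)) (signedCount-replicate k m l) ⟩
  weight l k ℤ.+ + m ℤ.* weight l k              ≡⟨ ℤ.suc-* (+ m) (weight l k) ⟨
  + suc m ℤ.* weight l k                         ∎

signedCount-replicate³ : ∀ k m₁ m₂ m₃ l₁ l₂ l₃ →
  signedCount k (replicate m₁ l₁ ++ replicate m₂ l₂ ++ replicate m₃ l₃) ≡
  + m₁ ℤ.* weight l₁ k ℤ.+ (+ m₂ ℤ.* weight l₂ k ℤ.+ + m₃ ℤ.* weight l₃ k)
signedCount-replicate³ k m₁ m₂ m₃ l₁ l₂ l₃ = begin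
  signedCount k (replicate m₁ l₁ ++ replicate m₂ l₂ ++ replicate m₃ l₃)
    ≡⟨ signedCount-++ k (replicate m₁ l₁) _ ⟩
  signedCount k (replicate m₁ l₁) ℤ.+ signedCount k (replicate m₂ l₂ ++ replicate m₃ l₃)
    ≡⟨ cong₂ ℤ._+_ (signedCount-replicate k m₁ l₁) (signedCount-++ k (replicate m₂ l₂) _) ⟩
  + m₁ ℤ.* weight l₁ k ℤ.+ (signedCount k (replicate m₂ l₂) ℤ.+ signedCount k (replicate m₃ l₃))
    ≡⟨ cong (ℤ._+_ (+ m₁ ℤ.* weight l₁ k)) (cong₂ ℤ._+_ (signedCount-replicate k m₂ l₂) (signedCount-replicate k m₃ l₃)) ⟩
  + m₁ ℤ.* weight l₁ k ℤ.+ (+ m₂ ℤ.* weight l₂ k ℤ.+ + m₃ ℤ.* weight l₃ k)  ∎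

-- The recurrence operator and the succession rule.

shift : (ℕ → ℤ) → ℕ → ℤ
shift g zero    = 0ℤ
shift g (suc k) = g k

shift-+ : ∀ g h k → shift (λ i → g i ℤ.+ h i) k ≡ shift g k ℤ.+ shift h k
shift-+ g h zero    = refl
shift-+ g h (suc k) = refl

δ-+1 : ∀ j k → δ (j ℕ.+ 1) k ≡ shift (δ j) k
δ-+1 j k rewrite ℕ.+-comm j 1 with k
... | zero  = refl
... | suc _ = refl

shift-neg : ∀ g k → shift (λ i → - g i) k ≡ - shift g k
shift-neg g zero    = refl
shift-neg g (suc k) = refl

deriv : (ℕ → ℤ) → ℕ → ℤ
deriv g k = + suc k ℤ.* g (suc k)

-- The action of x + 2a d/dx + 4b (d/dx)³ on coefficient sequences.
module _ (a b : ℤ) where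

  lower step : (ℕ → ℤ) → ℕ → ℤ
  lower g k = + 2 ℤ.* a ℤ.* deriv g k ℤ.+ + 4 ℤ.* b ℤ.* deriv (deriv (deriv g)) k
  step g k = shift g k ℤ.+ lower g k

  step-+ : ∀ g h k → step (λ i → g i ℤ.+ h i) k ≡ step g k ℤ.+ step h k
  step-+ g h k = trans (cong (ℤ._+ lower (λ i → g i ℤ.+ h i) k) (shift-+ g h k))
    (linear (shift g k) (shift h k) (+ 2 ℤ.* a) (+ suc k) (g (suc k)) (h (suc k))
            (+ 4 ℤ.* b) (+ (2 ℕ.+ k)) (+ (3 ℕ.+ k)) (g (3 ℕ.+ k)) (h (3 ℕ.+ k)))
    where
    linear : ∀ s s′ a c u v b d e u′ v′ →
      s ℤ.+ s′ ℤ.+ (a ℤ.* (c ℤ.* (u ℤ.+ v)) ℤ.+ b ℤ.* (c ℤ.* (d ℤ.* (e ℤ.* (u′ ℤ.+ v′))))) ≡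
      s ℤ.+ (a ℤ.* (c ℤ.* u) ℤ.+ b ℤ.* (c ℤ.* (d ℤ.* (e ℤ.* u′)))) ℤ.+
      (s′ ℤ.+ (a ℤ.* (c ℤ.* v) ℤ.+ b ℤ.* (c ℤ.* (d ℤ.* (e ℤ.* v′)))))
    linear = ℤ.solve-∀

  step-neg : ∀ g k → step (λ i → - g i) k ≡ - step g k
  step-neg g k = trans (cong (ℤ._+ lower (λ i → - g i) k) (shift-neg g k))
    (linear (shift g k) (+ 2 ℤ.* a) (+ suc k) (g (suc k)) (+ 4 ℤ.* b) (+ (2 ℕ.+ k)) (+ (3 ℕ.+ k)) (g (3 ℕ.+ k)))
    where
    linear : ∀ s a c u b d e v →
      - s ℤ.+ (a ℤ.* (c ℤ.* - u) ℤ.+ b ℤ.* (c ℤ.* (d ℤ.* (e ℤ.* - v)))) ≡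
      - (s ℤ.+ (a ℤ.* (c ℤ.* u) ℤ.+ b ℤ.* (c ℤ.* (d ℤ.* (e ℤ.* v)))))
    linear = ℤ.solve-∀

  step-0 : ∀ k → step (λ _ → 0ℤ) k ≡ 0ℤ
  step-0 k = trans (cong (ℤ._+ lower (λ _ → 0ℤ) k) (shift-0 k))
    (vanish (+ 2 ℤ.* a) (+ suc k) (+ 4 ℤ.* b) (+ (2 ℕ.+ k)) (+ (3 ℕ.+ k)))
    where
    shift-0 : ∀ k → shift (λ _ → 0ℤ) k ≡ 0ℤ
    shift-0 zero    = refl
    shift-0 (suc k) = refl
    vanish : ∀ a c b d e → 0ℤ ℤ.+ (a ℤ.* (c ℤ.* 0ℤ) ℤ.+ b ℤ.* (c ℤ.* (d ℤ.* (e ℤ.* 0ℤ)))) ≡ 0ℤ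
    vanish = ℤ.solve-∀

  step-cong : ∀ {g h : ℕ → ℤ} → (∀ k → g k ≡ h k) → ∀ k → step g k ≡ step h k
  step-cong {g} {h} e k = cong₂ ℤ._+_ (shift-cong k)
    (cong₂ (λ u v → + 2 ℤ.* a ℤ.* (+ suc k ℤ.* u) ℤ.+ + 4 ℤ.* b ℤ.* (+ suc k ℤ.* (+ (2 ℕ.+ k) ℤ.* (+ (3 ℕ.+ k) ℤ.* v))))
           (e (suc k)) (e (3 ℕ.+ k)))
    where
    shift-cong : ∀ k → shift g k ≡ shift h k
    shift-cong zero    = refl
    shift-cong (suc k) = e k

  module _ (∣a∣≡a : + ∣ a ∣ ≡ a) (∣b∣≡-b : + ∣ b ∣ ≡ - b) where

    down₁ : ∀ j k → + (2 ℕ.* ∣ a ∣ ℕ.* j) ℤ.* δ (j ℕ.∸ 1) k ≡ + 2 ℤ.* a ℤ.* deriv (δ j) k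
    down₁ j k = begin
      + (2 ℕ.* ∣ a ∣ ℕ.* j) ℤ.* δ (j ℕ.∸ 1) k        ≡⟨ cong (ℤ._* δ (j ℕ.∸ 1) k) (trans (ℤ.pos-* (2 ℕ.* ∣ a ∣) j) (cong (ℤ._* + j) (trans (ℤ.pos-* 2 ∣ a ∣) (cong (+ 2 ℤ.*_) ∣a∣≡a)))) ⟩
      + 2 ℤ.* a ℤ.* + j ℤ.* δ (j ℕ.∸ 1) k            ≡⟨ ℤ.*-assoc (+ 2 ℤ.* a) (+ j) _ ⟩
      + 2 ℤ.* a ℤ.* (+ j ℤ.* δ (j ℕ.∸ 1) k)          ≡⟨ cong (+ 2 ℤ.* a ℤ.*_) (δ-∸1 j k) ⟩
      + 2 ℤ.* a ℤ.* deriv (δ j) k        ∎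

    -- Two signs cancel: the change of mark contributes one, and |b| = -b the other. The 24 then
    -- splits as 4 · 6, the 6 clearing the binomial.
    down₃ : ∀ j k → + (24 ℕ.* ∣ b ∣ ℕ.* (j C 3)) ℤ.* - δ (j ℕ.∸ 3) k ≡
      + 4 ℤ.* b ℤ.* deriv (deriv (deriv (δ j))) k
    down₃ j k = begin
      + (24 ℕ.* ∣ b ∣ ℕ.* (j C 3)) ℤ.* - δ (j ℕ.∸ 3) k
        ≡⟨ cong (ℤ._* - δ (j ℕ.∸ 3) k) (trans (ℤ.pos-* (24 ℕ.* ∣ b ∣) (j C 3)) (cong (ℤ._* + (j C 3)) (trans (ℤ.pos-* 24 ∣ b ∣) (cong (+ 24 ℤ.*_) ∣b∣≡-b)))) ⟩
      + 24 ℤ.* - b ℤ.* + (j C 3) ℤ.* - δ (j ℕ.∸ 3) k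
        ≡⟨ signs b (+ (j C 3)) (δ (j ℕ.∸ 3) k) ⟩
      + 24 ℤ.* b ℤ.* (+ (j C 3) ℤ.* δ (j ℕ.∸ 3) k)
        ≡⟨ cong (+ 24 ℤ.* b ℤ.*_) (δ-∸3 j k) ⟩
      + 24 ℤ.* b ℤ.* (+ ((3 ℕ.+ k) C 3) ℤ.* d)
        ≡⟨ regroup b (+ ((3 ℕ.+ k) C 3)) d ⟩
      + 4 ℤ.* b ℤ.* (+ 6 ℤ.* + ((3 ℕ.+ k) C 3) ℤ.* d)
        ≡⟨ cong (λ u → + 4 ℤ.* b ℤ.* (u ℤ.* d)) 6*C ⟩
      + 4 ℤ.* b ℤ.* (+ suc k ℤ.* (+ (2 ℕ.+ k) ℤ.* + (3 ℕ.+ k)) ℤ.* d)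
        ≡⟨ cong (+ 4 ℤ.* b ℤ.*_) (reassoc (+ suc k) (+ (2 ℕ.+ k)) (+ (3 ℕ.+ k)) d) ⟩
      + 4 ℤ.* b ℤ.* deriv (deriv (deriv (δ j))) k  ∎
      where
      d = δ j (3 ℕ.+ k)
      signs : ∀ b c d → + 24 ℤ.* - b ℤ.* c ℤ.* - d ≡ + 24 ℤ.* b ℤ.* (c ℤ.* d)
      signs = ℤ.solve-∀
      regroup : ∀ b c d → + 24 ℤ.* b ℤ.* (c ℤ.* d) ≡ + 4 ℤ.* b ℤ.* (+ 6 ℤ.* c ℤ.* d)
      regroup = ℤ.solve-∀
      reassoc : ∀ u v w d → u ℤ.* (v ℤ.* w) ℤ.* d ≡ u ℤ.* (v ℤ.* (w ℤ.* d))
      reassoc = ℤ.solve-∀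
      6*C : + 6 ℤ.* + ((3 ℕ.+ k) C 3) ≡ + suc k ℤ.* (+ (2 ℕ.+ k) ℤ.* + (3 ℕ.+ k))
      6*C = begin
        + 6 ℤ.* + ((3 ℕ.+ k) C 3)                        ≡⟨ ℤ.pos-* 6 ((3 ℕ.+ k) C 3) ⟨
        + (6 ℕ.* ((3 ℕ.+ k) C 3))                        ≡⟨ cong +_ (6*[3+k]C3 k) ⟩
        + (suc k ℕ.* ((2 ℕ.+ k) ℕ.* (3 ℕ.+ k)))          ≡⟨ ℤ.pos-* (suc k) _ ⟩
        + suc k ℤ.* + ((2 ℕ.+ k) ℕ.* (3 ℕ.+ k))          ≡⟨ cong (+ suc k ℤ.*_) (ℤ.pos-* (2 ℕ.+ k) (3 ℕ.+ k)) ⟩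
        + suc k ℤ.* (+ (2 ℕ.+ k) ℤ.* + (3 ℕ.+ k))        ∎

    -- The three groups of children are the three terms of the operator applied to the monomial of
    -- the parent.
    signedCount-children : ∀ l k → signedCount k (children a b l) ≡ step (weight l) k
    signedCount-children ⟨ j ⟩ k = begin
      signedCount k (children a b ⟨ j ⟩)
        ≡⟨ signedCount-replicate³ k (24 ℕ.* ∣ b ∣ ℕ.* (j C 3)) (2 ℕ.* ∣ a ∣ ℕ.* j) 1 ⟨ j ℕ.∸ 3 ⟩‾ ⟨ j ℕ.∸ 1 ⟩ ⟨ j ℕ.+ 1 ⟩ ⟩
      + (24 ℕ.* ∣ b ∣ ℕ.* (j C 3)) ℤ.* - δ (j ℕ.∸ 3) k ℤ.+ (+ (2 ℕ.* ∣ a ∣ ℕ.* j) ℤ.* δ (j ℕ.∸ 1) k ℤ.+ + 1 ℤ.* δ (j ℕ.+ 1) k)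
        ≡⟨ cong₂ ℤ._+_ (down₃ j k) (cong₂ ℤ._+_ (down₁ j k) (trans (ℤ.*-identityˡ _) (δ-+1 j k))) ⟩
      t₃ ℤ.+ (t₁ ℤ.+ shift (δ j) k)
        ≡⟨ reorder t₃ t₁ (shift (δ j) k) ⟩
      step (δ j) k  ∎
      where
      t₁ = + 2 ℤ.* a ℤ.* deriv (δ j) k
      t₃ = + 4 ℤ.* b ℤ.* deriv (deriv (deriv (δ j))) k
      reorder : ∀ u v w → u ℤ.+ (v ℤ.+ w) ≡ w ℤ.+ (v ℤ.+ u)
      reorder = ℤ.solve-∀
    -- The rule for a marked label is the unmarked rule with every mark flipped, and flipping marks
    -- negates the signed count.
    signedCount-children ⟨ j ⟩‾ k = begin
      signedCount k (children a b ⟨ j ⟩‾)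
        ≡⟨ signedCount-replicate³ k m₃ m₁ 1 ⟨ j ℕ.∸ 3 ⟩ ⟨ j ℕ.∸ 1 ⟩‾ ⟨ j ℕ.+ 1 ⟩‾ ⟩
      + m₃ ℤ.* δ (j ℕ.∸ 3) k ℤ.+ (+ m₁ ℤ.* - δ (j ℕ.∸ 1) k ℤ.+ + 1 ℤ.* - δ (j ℕ.+ 1) k)
        ≡⟨ negate (+ m₃) (δ (j ℕ.∸ 3) k) (+ m₁) (δ (j ℕ.∸ 1) k) (+ 1) (δ (j ℕ.+ 1) k) ⟩
      - (+ m₃ ℤ.* - δ (j ℕ.∸ 3) k ℤ.+ (+ m₁ ℤ.* δ (j ℕ.∸ 1) k ℤ.+ + 1 ℤ.* δ (j ℕ.+ 1) k))
        ≡⟨ cong -_ (signedCount-replicate³ k m₃ m₁ 1 ⟨ j ℕ.∸ 3 ⟩‾ ⟨ j ℕ.∸ 1 ⟩ ⟨ j ℕ.+ 1 ⟩) ⟨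
      - signedCount k (children a b ⟨ j ⟩)  ≡⟨ cong -_ (signedCount-children ⟨ j ⟩ k) ⟩
      - step (δ j) k                        ≡⟨ step-neg (δ j) k ⟨
      step (weight ⟨ j ⟩‾) k                ∎
      where
      m₁ = 2 ℕ.* ∣ a ∣ ℕ.* j
      m₃ = 24 ℕ.* ∣ b ∣ ℕ.* (j C 3)
      negate : ∀ u x v y w z → u ℤ.* x ℤ.+ (v ℤ.* - y ℤ.+ w ℤ.* - z) ≡ - (u ℤ.* - x ℤ.+ (v ℤ.* y ℤ.+ w ℤ.* z))
      negate = ℤ.solve-∀

    -- Linearity of `step` extends the one-node identity to a whole level.
    signedCount-concatMap : ∀ ls k → signedCount k (concatMap (children a b) ls) ≡ step (λ i → signedCount i ls) k
    signedCount-concatMap []       k = sym (step-0 k)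
    signedCount-concatMap (l ∷ ls) k = begin
      signedCount k (children a b l ++ concatMap (children a b) ls)
        ≡⟨ signedCount-++ k (children a b l) _ ⟩
      signedCount k (children a b l) ℤ.+ signedCount k (concatMap (children a b) ls)
        ≡⟨ cong₂ ℤ._+_ (signedCount-children l k) (signedCount-concatMap ls k) ⟩
      step (weight l) k ℤ.+ step (λ i → signedCount i ls) k
        ≡⟨ step-+ (weight l) _ k ⟨
      step (λ i → weight l i ℤ.+ signedCount i ls) k
        ≡⟨ step-cong (λ i → signedCount-∷ i l ls) k ⟨
      step (λ i → signedCount i (l ∷ ls)) k  ∎

-- Comparison of the two recurrences after clearing factorials.

fromℤ-*-exchange : ∀ c i u v → c * u ≡ fromℤ v → c * (fromℤ i * u) ≡ fromℤ (i ℤ.* v)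
fromℤ-*-exchange c i u v cu≡v = begin
  c * (fromℤ i * u)     ≡⟨ *-exchange c (fromℤ i) u ⟩
  fromℤ i * (c * u)     ≡⟨ cong (fromℤ i *_) cu≡v ⟩
  fromℤ i * fromℤ v     ≡⟨ fromℤ-homo-* i v ⟨
  fromℤ (i ℤ.* v)       ∎

fromℤ-*-exchange₂ : ∀ c i j u v → c * u ≡ fromℤ v → c * (fromℤ i * fromℤ j * u) ≡ fromℤ (i ℤ.* j ℤ.* v)
fromℤ-*-exchange₂ c i j u v cu≡v =
  trans (cong (λ t → c * (t * u)) (sym (fromℤ-homo-* i j))) (fromℤ-*-exchange c (i ℤ.* j) u v cu≡v)

module _ (a b : ℤ) (∣a∣≡a : + ∣ a ∣ ≡ a) (∣b∣≡-b : + ∣ b ∣ ≡ - b) where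

  private
    E = expCoeffs (cofactor (fromℤ a) (fromℤ b))

    w : ℕ → ℕ → ℤ
    w n k = signedCount k (level a b n)

  -- Since (n + 1)! = (n + 1) · n!, scaling by the factorial supplies exactly the factor n + 1 of
  -- `exp-recurrence`. The scaled coefficients therefore follow the integer recurrence `step`.
  n!*exp≡signedCount : ∀ n k → fromℕ (n !) * E n k ≡ fromℤ (w n k)
  n!*exp≡signedCount zero    zero    = refl
  n!*exp≡signedCount zero    (suc k) = refl
  n!*exp≡signedCount (suc n) k = begin
    fromℕ (suc n !) * E (suc n) k
      ≡⟨ cong (_* E (suc n) k) (fromℕ-homo-* (suc n) (n !)) ⟩
    fromℕ (suc n) * N * E (suc n) k
      ≡⟨ solve 3 (λ s n e → s :* n :* e := n :* (s :* e)) refl (fromℕ (suc n)) N (E (suc n) k) ⟩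
    N * (fromℕ (suc n) * E (suc n) k)
      ≡⟨ cong (N *_) (exp-recurrence (fromℤ a) (fromℤ b) n k) ⟩
    N * ((x· E) n k + (t₁ + t₃))
      ≡⟨ solve 4 (λ n u v w → n :* (u :+ (v :+ w)) := n :* u :+ (n :* v :+ n :* w)) refl N ((x· E) n k) t₁ t₃ ⟩
    N * (x· E) n k + (N * t₁ + N * t₃)
      ≡⟨ cong₂ _+_ (x-part k) (cong₂ _+_
           (fromℤ-*-exchange₂ N (+ 2) a _ (deriv (w n) k) (deriv-part E (w n) IH k))
           (fromℤ-*-exchange₂ N (+ 4) b _ (deriv (deriv (deriv (w n))) k)
             (deriv-part (∂/∂x (∂/∂x E)) (deriv (deriv (w n))) (deriv-part (∂/∂x E) (deriv (w n)) (deriv-part E (w n) IH)) k))) ⟩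
    fromℤ (shift (w n) k) + (fromℤ s₁ + fromℤ s₃)
      ≡⟨ cong (λ u → fromℤ (shift (w n) k) + u) (fromℤ-homo-+ s₁ s₃) ⟨
    fromℤ (shift (w n) k) + fromℤ (s₁ ℤ.+ s₃)
      ≡⟨ fromℤ-homo-+ (shift (w n) k) (s₁ ℤ.+ s₃) ⟨
    fromℤ (step a b (w n) k)
      ≡⟨ cong fromℤ (signedCount-concatMap a b ∣a∣≡a ∣b∣≡-b (level a b n) k) ⟨
    fromℤ (w (suc n) k)  ∎
    where
    N = fromℕ (n !)
    -- All k at once, because the three terms read degree n at k - 1, k + 1 and k + 3.
    IH : ∀ k → N * E n k ≡ fromℤ (w n k)
    IH = n!*exp≡signedCount n
    t₁ = fromℕ 2 * fromℤ a * ∂/∂x E n k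
    t₃ = fromℕ 4 * fromℤ b * ∂/∂x (∂/∂x (∂/∂x E)) n k
    s₁ = + 2 ℤ.* a ℤ.* deriv (w n) k
    s₃ = + 4 ℤ.* b ℤ.* deriv (deriv (deriv (w n))) k
    deriv-part : ∀ g v → (∀ k → N * g n k ≡ fromℤ (v k)) → ∀ k → N * ∂/∂x g n k ≡ fromℤ (deriv v k)
    deriv-part g v Ng≡v k = fromℤ-*-exchange N (+ suc k) _ (v (suc k)) (Ng≡v (suc k))
    x-part : ∀ k → N * (x· E) n k ≡ fromℤ (shift (w n) k)
    x-part zero    = ℚ.*-zeroʳ N
    x-part (suc k) = IH k

theorem18 : (a b : ℤ) → 0ℤ < a → b < 0ℤ →
    (P : ℕ → Poly) → egf P ≈ₛ exp (exponent a b) (exponent₀≈0 a b) →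
    (n k : ℕ) → k ≤ n →
    [x^ k ] P n ≡ fromℤ (+ μ a b n ⟨ k ⟩ - + μ a b n ⟨ k ⟩‾)
-- Once the signs are exposed, |a| = a and |b| = -b hold by computation.
theorem18 a@(+ _) b@(-[1+ _ ]) (+<+ _) -<+ P egf≈exp n k _ =
  trans (coeff-egf a b P egf≈exp n k) (n!*exp≡signedCount a b refl refl n k)
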